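{- For every integer $k\geq 1$, the class $\mathcal{U}^{k+1}_{MIS}$ is strictly included in the class $\mathcal{U}^{k}_{MIS}$.
   Context: Graphs are finite, simple and undirected. A maximal independent set (MIS) is a set of pairwise non-adjacent vertices that is maximal under inclusion with this property. An MIS $S$ of $G=(V,E)$ is $k$-robust if for every set $F\subseteq E$ of at most $k$ edges, either the graph $G-F=(V,E\setminus F)$ is disconnected, or $S$ is still a maximal independent set of $G-F$. $\mathcal{U}^k_{MIS}$ is the class of graphs $G$ such that every maximal independent set of $G$ is $k$-robust. -}

module Defs where

open import Data.Fin using (Fin)
open import Data.Fin.Properties using (_≟_)
open import Data.Fin.Subset using (Subset; _∈_; _⊆_)
open import Data.List using (List; length)
open import Data.List.Relation.Unary.All using (All)
open import Data.Nat using (ℕ; _≤_)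
open import Data.Product using (_×_; _,_; uncurry)
open import Data.Product.Properties using (≡-dec)
open import Data.Sum using (_⊎_)
open import Level using (0ℓ)
open import Relation.Binary.Construct.Closure.ReflexiveTransitive using (Star)
open import Relation.Binary.Core using (Rel)
open import Relation.Binary.Definitions using (Symmetric; Irreflexive; Decidable; DecidableEquality)
open import Relation.Binary.PropositionalEquality using (_≡_)
open import Relation.Nullary using (¬_)
open import Relation.Nullary.Decidable using (_×-dec_)
open import Relation.Unary using (Pred)
import Data.List.Membership.DecPropositional as DecMembership

record Graph : Set₁ where
  infix 4 _~_
  field
    n      : ℕ
    _~_    : Rel (Fin n) 0ℓ
    ~-sym  : Symmetric _~_
    ~-irr  : Irreflexive _≡_ _~_
    _~?_   : Decidable _~_

  Vertex : Set
  Vertex = Fin n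

  -- (u , v) and (v , u) both stand for the undirected edge {u,v}.
  Edge : Set
  Edge = Vertex × Vertex

  _≟ᵉ_ : DecidableEquality Edge
  _≟ᵉ_ = ≡-dec _≟_ _≟_

open Graph using (n; Vertex; Edge)

Connected : Graph → Set
Connected G = ∀ u v → Star _~_ u v
  where open Graph G

Independent : (G : Graph) → Pred (Subset (n G)) 0ℓ
Independent G S = ∀ {u v} → u ∈ S → v ∈ S → ¬ (u ~ v)
  where open Graph G

MIS : (G : Graph) → Pred (Subset (n G)) 0ℓ
MIS G S = Independent G S × (∀ {T} → Independent G T → S ⊆ T → T ⊆ S)

-- An edge is removed when either of its orientations is listed.
infixl 6 _-_
_-_ : (G : Graph) → List (Edge G) → Graph
G - F = record
  { n     = n G
  ; _~_   = λ u v → u ~ v × (u , v) ∉ F × (v , u) ∉ F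
  ; ~-sym = λ { (u~v , p , q) → ~-sym u~v , q , p }
  ; ~-irr = λ { u≡v (u~v , _) → ~-irr u≡v u~v }
  ; _~?_  = λ u v → (u ~? v) ×-dec ((u , v) ∉? F) ×-dec ((v , u) ∉? F)
  }
  where
  open Graph G hiding (n)
  open DecMembership _≟ᵉ_ using (_∉_; _∉?_)

-- A set of edges has at most k elements exactly when it is enumerated,
-- possibly with repetitions, by a list of length at most k; so F ranges over
-- such lists.
Robust : ℕ → (G : Graph) → Pred (Subset (n G)) 0ℓ
Robust k G S =
  ∀ (F : List (Edge G)) → All (uncurry _~_) F → length F ≤ k →
  ¬ Connected (G - F) ⊎ MIS (G - F) S
  where open Graph G using (_~_)

𝓤 : ℕ → Pred Graph 0ℓ
𝓤 k G = ∀ S → MIS G S → Robust k G S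

-- The inclusion is monotonicity in k. For strictness take the complete
-- tripartite graph with parts of size k + 1. Its maximal independent sets are
-- the three parts, so a vertex outside such a set S has exactly k + 1
-- neighbours in S: k deletions cannot undo its domination, whereas k + 1
-- deletions can, and the third part then keeps the graph connected.
{-# OPTIONS --safe #-}
module Submission where

open import Defs
open import Data.Nat using (ℕ; suc; _≤_)
open import Data.Product using (_×_)
open import Relation.Unary using (_⊆_; _∖_; Satisfiable)

open import Data.Bool using (true)
open import Data.Fin using (Fin; combine; quotient; remainder)
open import Data.Fin.Patterns using (0F; 1F; 2F)
open import Data.Fin.Properties
  using (_≟_; any?; pigeonhole; <⇒≢; remQuot-combine; combine-remQuot; combine-injectiveʳ)
open import Data.Fin.Subset using (Subset; _∈_; _∪_; ⁅_⁆)
open import Data.Fin.Subset.Properties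
  using (_∈?_; x∈p∪q⁻; p⊆p∪q; q⊆p∪q; x∈⁅x⁆; x∈⁅y⁆⇒x≡y)
open import Data.List using (List; length; tabulate; lookup)
open import Data.List.Membership.Propositional using () renaming (_∈_ to _∈ˡ_)
open import Data.List.Membership.Propositional.Properties using (∈-tabulate⁺; ∈-tabulate⁻)
open import Data.List.Properties using (length-tabulate)
open import Data.List.Relation.Unary.All using (All)
import Data.List.Relation.Unary.All.Properties as All
open import Data.List.Relation.Unary.Any using (index)
open import Data.List.Relation.Unary.Any.Properties using (lookup-index)
open import Data.Nat using (_*_; s≤s)
open import Data.Nat.Properties using (m≤n⇒m≤1+n; ≤-reflexive)
open import Data.Product using (_,_; proj₁; proj₂; uncurry)
open import Data.Sum using (_⊎_; inj₁; inj₂)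
import Data.Vec as Vec
open import Data.Vec.Properties using (lookup∘tabulate; []=⇒lookup; lookup⇒[]=)
open import Function using (_∘_)
open import Relation.Binary.Construct.Closure.ReflexiveTransitive using (Star; ε; _◅_; _◅◅_; reverse)
open import Relation.Binary.PropositionalEquality
  using (_≡_; _≢_; refl; sym; trans; cong; subst; ≢-sym)
open import Relation.Nullary using (¬_; Dec; yes; no; contradiction)
open import Relation.Nullary.Decidable using (does; dec-true; ¬?; _×-dec_; decidable-stable)
open import Relation.Unary using (Pred; Decidable)
open import Level using (0ℓ)

open Graph using (n; Vertex; Edge)

𝓤-antitone : ∀ k → 𝓤 (suc k) ⊆ 𝓤 k
𝓤-antitone k U S mis F F⊆E |F|≤k = U S mis F F⊆E (m≤n⇒m≤1+n |F|≤k)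

module _ {n} {P : Pred (Fin n) 0ℓ} (P? : Decidable P) where

  comprehension : Subset n
  comprehension = Vec.tabulate (does ∘ P?)

  ∈-comprehension⁺ : ∀ {x} → P x → x ∈ comprehension
  ∈-comprehension⁺ {x} px =
    lookup⇒[]= x _ (trans (lookup∘tabulate (does ∘ P?) x) (dec-true (P? x) px))

  ∈-comprehension⁻ : ∀ {x} → x ∈ comprehension → P x
  ∈-comprehension⁻ {x} x∈ = extract (P? x) (trans (sym (lookup∘tabulate (does ∘ P?) x)) ([]=⇒lookup x∈))
    where
    extract : (d : Dec (P x)) → does d ≡ true → P x
    extract (yes px) _ = px

module _ (G : Graph) where
  open Graph G using (_~_; ~-sym; ~-irr)

  ∪⁅⁆-independent : ∀ {S v} → Independent G S → (∀ {w} → w ∈ S → ¬ (v ~ w)) →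
                    Independent G (S ∪ ⁅ v ⁆)
  ∪⁅⁆-independent {S} {v} ind v≁S {x} {y} x∈ y∈ x~y
    with x∈p∪q⁻ S ⁅ v ⁆ x∈ | x∈p∪q⁻ S ⁅ v ⁆ y∈
  ... | inj₁ x∈S | inj₁ y∈S = ind x∈S y∈S x~y
  ... | inj₁ x∈S | inj₂ y∈v with refl ← x∈⁅y⁆⇒x≡y v y∈v = v≁S x∈S (~-sym x~y)
  ... | inj₂ x∈v | inj₁ y∈S with refl ← x∈⁅y⁆⇒x≡y v x∈v = v≁S y∈S x~y
  ... | inj₂ x∈v | inj₂ y∈v =
    ~-irr (trans (x∈⁅y⁆⇒x≡y v x∈v) (sym (x∈⁅y⁆⇒x≡y v y∈v))) x~y

  -- Adjoining `v` keeps `S` independent, so maximality already puts `v` in `S`. Maximality is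
  -- exploited in this form both in the original graph and after edges are deleted.
  MIS-absorbs : ∀ {S v} → MIS G S → (∀ {w} → w ∈ S → ¬ (v ~ w)) → v ∈ S
  MIS-absorbs {S} {v} (ind , max) v≁S =
    max (∪⁅⁆-independent ind v≁S) (p⊆p∪q ⁅ v ⁆) (q⊆p∪q S ⁅ v ⁆ (x∈⁅x⁆ v))

-- Each entry of `F` can serve only one `w i`. By pigeonhole two distinct indices are served from
-- the same position of `F`, and comparing components of that entry gives `w i ≡ w j`. If the two
-- orientations differ, the comparison gives `w i ≡ v` or `w j ≡ v` in some form, which `w≢v`
-- excludes.
¬-cover : ∀ {A : Set} {m} (F : List (A × A)) → length F ≤ m →
          (v : A) (w : Fin (suc m) → A) → (∀ {i j} → w i ≡ w j → i ≡ j) → (∀ i → w i ≢ v) →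
          ¬ (∀ i → (w i , v) ∈ˡ F ⊎ (v , w i) ∈ˡ F)
¬-cover F |F|≤m v w w-inj w≢v cover =
  let i , j , i<j , same = pigeonhole (s≤s |F|≤m) (position ∘ cover)
  in  <⇒≢ i<j (w-inj (endpoint (cover i) (cover j) same))
  where
  position : ∀ {i} → (w i , v) ∈ˡ F ⊎ (v , w i) ∈ˡ F → Fin (length F)
  position (inj₁ e) = index e
  position (inj₂ e) = index e

  index-injective : ∀ {e f} (p : e ∈ˡ F) (q : f ∈ˡ F) → index p ≡ index q → e ≡ f
  index-injective p q eq = trans (lookup-index p) (trans (cong (lookup F) eq) (sym (lookup-index q)))

  endpoint : ∀ {i j} (p : (w i , v) ∈ˡ F ⊎ (v , w i) ∈ˡ F) (q : (w j , v) ∈ˡ F ⊎ (v , w j) ∈ˡ F) →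
             position p ≡ position q → w i ≡ w j
  endpoint (inj₁ p) (inj₁ q) eq = cong proj₁ (index-injective p q eq)
  endpoint (inj₁ p) (inj₂ q) eq = contradiction (cong proj₁ (index-injective p q eq)) (w≢v _)
  endpoint (inj₂ p) (inj₁ q) eq = contradiction (cong proj₂ (index-injective p q eq)) (w≢v _)
  endpoint (inj₂ p) (inj₂ q) eq = cong proj₂ (index-injective p q eq)

-- There are `p` parts of `q` vertices each; `combine i j` is vertex `j` of part `i`.
completeMultipartite : ℕ → ℕ → Graph
completeMultipartite p q = record
  { n     = p * q
  ; _~_   = λ u v → quotient {p} q u ≢ quotient q v
  ; ~-sym = ≢-sym
  ; ~-irr = λ { refl u≁u → u≁u refl }
  ; _~?_  = λ u v → ¬? (quotient q u ≟ quotient q v)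
  }

module _ {p q : ℕ} where
  private
    K : Graph
    K = completeMultipartite p q

    part : Vertex K → Fin p
    part = quotient q

  quotient-combine : ∀ (i : Fin p) (j : Fin q) → quotient q (combine i j) ≡ i
  quotient-combine i j = cong proj₁ (remQuot-combine i j)

  -- Vertices of one part have the same neighbours, and `w` has none in `S`.
  part⊆MIS : ∀ {S w} → MIS K S → w ∈ S → ∀ i → combine (part w) i ∈ S
  part⊆MIS {S} {w} mis w∈S i = MIS-absorbs K mis λ x∈S cross →
    proj₁ mis w∈S x∈S (cross ∘ trans (quotient-combine (part w) i))

completeMultipartite∈𝓤 : ∀ p k → 𝓤 k (completeMultipartite p (suc k))
completeMultipartite∈𝓤 p k S mis F F⊆E |F|≤k =
  inj₂ ((λ x∈S y∈S x~y → proj₁ mis x∈S y∈S (proj₁ x~y)) , maximal)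
  where
  K : Graph
  K = completeMultipartite p (suc k)

  open Graph K using (_≟ᵉ_)
  open import Data.List.Membership.DecPropositional _≟ᵉ_ using () renaming (_∈?_ to _∈ˡ?_)

  part : Vertex K → Fin p
  part = quotient (suc k)

  maximal : ∀ {T} → Independent (K - F) T → (∀ {x} → x ∈ S → x ∈ T) → ∀ {x} → x ∈ T → x ∈ S
  maximal {T} ind S⊆T {v} v∈T with any? (λ w → (w ∈? S) ×-dec ¬? (part v ≟ part w))
  ... | no none = MIS-absorbs K mis λ w∈S cross → none (_ , w∈S , cross)
  -- The whole part of `w` lies in `S`, hence in `T`, and `v` is adjacent in `K` to all of it.
  -- Independence of `T` after the deletion means that all these `suc k` edges are in `F`, which
  -- lists at most `k`.
  ... | yes (w , w∈S , cross) =
    contradiction covered (¬-cover F |F|≤k v nbr (combine-injectiveʳ (part w) _ (part w) _) (λ i → nbr~v i ∘ cong part))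
    where
    nbr : Fin (suc k) → Vertex K
    nbr = combine (part w)

    nbr~v : ∀ i → part (nbr i) ≢ part v
    nbr~v i eq = cross (trans (sym eq) (quotient-combine (part w) i))

    covered : ∀ i → (nbr i , v) ∈ˡ F ⊎ (v , nbr i) ∈ˡ F
    covered i with (nbr i , v) ∈ˡ? F | (v , nbr i) ∈ˡ? F
    ... | yes e | _     = inj₁ e
    ... | no _  | yes e = inj₂ e
    ... | no e  | no e′ = contradiction (nbr~v i , e , e′) (ind (S⊆T (part⊆MIS mis w∈S i)) v∈T)

completeTripartite∉𝓤 : ∀ k → ¬ 𝓤 (suc k) (completeMultipartite 3 (suc k))
completeTripartite∉𝓤 k U = refute (U A A-MIS F F⊆E (≤-reflexive (length-tabulate spoke)))
  where
  K : Graph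
  K = completeMultipartite 3 (suc k)

  open Graph K using (_~_)

  part : Vertex K → Fin 3
  part = quotient (suc k)

  a b c : Fin (suc k) → Vertex K
  a = combine {3} 0F
  b = combine {3} 1F
  c = combine {3} 2F

  part-a : ∀ i → part (a i) ≡ 0F
  part-a = quotient-combine {3} 0F

  part-b : ∀ i → part (b i) ≡ 1F
  part-b = quotient-combine {3} 1F

  part-c : ∀ i → part (c i) ≡ 2F
  part-c = quotient-combine {3} 2F

  differ : ∀ u v {i j} → part u ≡ i → part v ≡ j → i ≢ j → u ~ v
  differ _ _ refl refl i≢j = i≢j

  inA? : Decidable (λ u → part u ≡ 0F)
  inA? u = part u ≟ 0F

  A : Subset (n K)
  A = comprehension inA?

  A-MIS : MIS K A
  A-MIS =
    (λ {u} {v} u∈A v∈A u~v →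
      u~v (trans (∈-comprehension⁻ inA? {u} u∈A) (sym (∈-comprehension⁻ inA? {v} v∈A)))) ,
    -- A vertex of `T` outside part `0F` would be adjacent to `a 0F`, which is in `T` too.
    λ ind A⊆T {t} t∈T → ∈-comprehension⁺ inA? (decidable-stable (inA? t) λ t∉A →
      ind (A⊆T (∈-comprehension⁺ inA? {a 0F} (part-a 0F))) t∈T
        (differ (a 0F) t (part-a 0F) refl (≢-sym t∉A)))

  -- These are all the edges between the single vertex `b 0F` and `A`.
  spoke : Fin (suc k) → Edge K
  spoke i = b 0F , a i

  F : List (Edge K)
  F = tabulate spoke

  open Graph (K - F) using () renaming (_~_ to _~′_; ~-sym to ~′-sym)

  F⊆E : All (uncurry _~_) F
  F⊆E = All.tabulate⁺ {f = spoke} λ i → differ (b 0F) (a i) (part-b 0F) (part-a i) λ ()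

  F-parts : ∀ {u v} → (u , v) ∈ˡ F → part u ≡ 1F × part v ≡ 0F
  F-parts e with i , refl ← ∈-tabulate⁻ {f = spoke} e = part-b 0F , part-a i

  -- Deleted edges join part `1F` to part `0F`, so every edge that meets part `2F` survives.
  toC : ∀ u v → part u ≢ 2F → part v ≡ 2F → u ~′ v
  toC u v u∉C v∈C =
    differ u v refl v∈C u∉C ,
    (λ e → contradiction (trans (sym v∈C) (proj₂ (F-parts e))) λ ()) ,
    (λ e → contradiction (trans (sym v∈C) (proj₁ (F-parts e))) λ ())

  toHub : ∀ u → Star _~′_ u (c 0F)
  toHub u with part u ≟ 2F
  ... | no u∉C  = toC u (c 0F) u∉C (part-c 0F) ◅ ε
  -- Part `2F` has no inner edges, so its vertices reach the hub `c 0F` through `a 0F`.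
  ... | yes u∈C =
    ~′-sym {a 0F} {u} (toC (a 0F) u a∉C u∈C) ◅ toC (a 0F) (c 0F) a∉C (part-c 0F) ◅ ε
    where
    a∉C : part (a 0F) ≢ 2F
    a∉C eq = contradiction (trans (sym (part-a 0F)) eq) λ ()

  connected : Connected (K - F)
  connected u v = toHub u ◅◅ reverse (λ {u} {v} → ~′-sym {u} {v}) (toHub v)

  -- A vertex `w` of part `0F` is `a` at the remainder of `w`, so its spoke is among those
  -- tabulated.
  ∈F : ∀ {w} → part w ≡ 0F → (b 0F , w) ∈ˡ F
  ∈F {w} w∈A = subst (λ x → (b 0F , x) ∈ˡ F)
    (trans (cong (λ i → combine i (remainder {3} (suc k) w)) (sym w∈A)) (combine-remQuot {3} (suc k) w))
    (∈-tabulate⁺ {f = spoke} (remainder {3} (suc k) w))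

  b≁A : ∀ {w} → w ∈ A → ¬ (b 0F ~′ w)
  b≁A {w} w∈A (_ , e∉F , _) = e∉F (∈F (∈-comprehension⁻ inA? w∈A))

  refute : ¬ (¬ Connected (K - F) ⊎ MIS (K - F) A)
  refute (inj₁ disconnected) = disconnected connected
  refute (inj₂ mis) =
    contradiction (trans (sym (part-b 0F)) (∈-comprehension⁻ inA? {b 0F} b∈A)) λ ()
    where
    -- With its spokes gone, `b 0F` has no neighbour in `A`, so maximality would force it into `A`,
    -- although it lies in part `1F`.
    b∈A : b 0F ∈ A
    b∈A = MIS-absorbs (K - F) mis λ {w} → b≁A {w}

theorem18 : ∀ (k : ℕ) → 1 ≤ k →
    (𝓤 (suc k) ⊆ 𝓤 k) × Satisfiable (𝓤 k ∖ 𝓤 (suc k))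
theorem18 k _ =
  (λ {G} → 𝓤-antitone k {G}) ,
  completeMultipartite 3 (suc k) , completeMultipartite∈𝓤 3 k , completeTripartite∉𝓤 k
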